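{- Let \(m\) be a positive integer that is not a perfect square, let \(a,b,c\) be positive integers with \(\gcd(a,b^2-c^2m)=1\), and let \(A,B\in\mathbb Z\). If \(A\geq (a-1)(b-1+cm)\) and \(B\geq (a-1)(b-1+c)\), then there exist \(x,y,z,w\in\mathbb N\) with \(a(x+y\sqrt m)+(b+c\sqrt m)(z+w\sqrt m)=A+B\sqrt m\).
   Context: \(\mathbb N\) denotes the set of non-negative integers. -}

module Defs where

open import Data.Nat using (ℕ)
import Data.Nat as ℕ
open import Data.Integer using (ℤ; +_; 0ℤ; _+_; _*_)
open import Data.Product using (∃)
open import Relation.Binary.PropositionalEquality using (_≡_)

PerfectSquare : ℕ → Set
PerfectSquare m = ∃ λ k → m ≡ k ℕ.* k

-- The ring ℤ[√m]: p +√ q stands for p + q√m.  When m is not a perfect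
-- square, √m is irrational, so 1 and √m are linearly independent over ℤ and
-- propositional equality of pairs is equality of the real numbers p + q√m.
record ℤ[√_] (m : ℕ) : Set where
  constructor _+√_
  field
    rational : ℤ
    surd     : ℤ

infix  5 _+√_
infixl 7 _⊗_
infixl 6 _⊕_

⟦_⟧ : ∀ {m} → ℤ → ℤ[√ m ]
⟦ p ⟧ = p +√ 0ℤ

_⊕_ : ∀ {m} → ℤ[√ m ] → ℤ[√ m ] → ℤ[√ m ]
(p +√ q) ⊕ (r +√ s) = p + r +√ q + s

_⊗_ : ∀ {m} → ℤ[√ m ] → ℤ[√ m ] → ℤ[√ m ]
_⊗_ {m} (p +√ q) (r +√ s) = p * r + + m * (q * s) +√ p * s + q * r

{-# OPTIONS --safe #-}

-- The equation splits into the pair of congruences bz + cmw ≡ A, cz + bw ≡ B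
-- modulo a, whose determinant b² − c²m is a unit modulo a.  Take its solution
-- with residues 0 ≤ z, w ≤ a − 1.  The bounds on A and B then give
-- A − bz − cmw ≥ −(a − 1) and B − cz − bw ≥ −(a − 1); being multiples of a,
-- both are non-negative, and x, y are the quotients.
module Submission where

open import Data.Nat using (ℕ; NonZero)
open import Data.Integer using (ℤ; +_; 1ℤ; _+_; _-_; _*_; _^_; _≥_)
open import Data.Integer.GCD using (gcd)
open import Data.Product using (∃-syntax)
open import Relation.Binary.PropositionalEquality using (_≡_)
open import Relation.Nullary using (¬_)
open import Defs

import Data.Nat as ℕ
open import Data.Integer using (0ℤ; -1ℤ; _≤_; _<_; -_; ∣_∣; +≤+; +<+)
open import Data.Integer.DivMod using (_/ℕ_; _%ℕ_; n%ℕd<d; a≡a%ℕn+[a/ℕn]*n)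
open import Data.Integer.Properties
open import Data.Integer.Tactic.RingSolver using (solve; solve-∀)
open import Data.List using ([]; _∷_)
open import Data.Nat.Coprimality using (coprime-Bézout; gcd≡1⇒coprime)
open import Data.Nat.GCD using (module Bézout)
open import Data.Product using (_,_; ∃₂)
open import Data.Sum using (inj₁; inj₂)
open import Relation.Binary.PropositionalEquality using (sym; trans; cong; cong₂; subst; module ≡-Reasoning)

∣i∣-multiple : ∀ i → ∃[ s ] s * i ≡ + ∣ i ∣
∣i∣-multiple i with +∣i∣≡i⊎+∣i∣≡-i i
... | inj₁ eq = 1ℤ , trans (*-identityˡ i) (sym eq)
... | inj₂ eq = -1ℤ , trans (-1*i≡-i i) (sym eq)

pos-1+* : ∀ k l m n → 1 ℕ.+ k ℕ.* l ≡ m ℕ.* n → 1ℤ + + k * + l ≡ + m * + n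
pos-1+* k l m n eq = begin
  1ℤ + + k * + l    ≡⟨ cong (λ p → 1ℤ + p) (pos-* k l) ⟨
  + (1 ℕ.+ k ℕ.* l) ≡⟨ cong +_ eq ⟩
  + (m ℕ.* n)       ≡⟨ pos-* m n ⟩
  + m * + n         ∎
  where open ≡-Reasoning

-- The identity over the naturals has two forms, according to which product exceeds the other by 1.
-- Negating the coefficient of the smaller product puts both into one signed form.
bézout-ℕ : ∀ m n → Bézout.Identity 1 m n → ∃₂ λ u v → u * + m + v * + n ≡ 1ℤ
bézout-ℕ m n (Bézout.+- x y eq) = + x , - + y , (begin
  + x * + m + - + y * + n         ≡⟨ cong (_+ - + y * + n) (pos-1+* y n x m eq) ⟨
  1ℤ + + y * + n + - + y * + n    ≡⟨ cancel (+ y) (+ n) ⟩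
  1ℤ                              ∎)
  where
  open ≡-Reasoning
  cancel : ∀ y n → 1ℤ + y * n + - y * n ≡ 1ℤ
  cancel = solve-∀
bézout-ℕ m n (Bézout.-+ x y eq) = - + x , + y , (begin
  - + x * + m + + y * + n         ≡⟨ cong (λ p → - + x * + m + p) (pos-1+* x m y n eq) ⟨
  - + x * + m + (1ℤ + + x * + m)  ≡⟨ cancel (+ x) (+ m) ⟩
  1ℤ                              ∎)
  where
  open ≡-Reasoning
  cancel : ∀ x m → - x * m + (1ℤ + x * m) ≡ 1ℤ
  cancel = solve-∀

-- The identity holds for the absolute values; the signs `s` and `t` are absorbed into the
-- coefficients.
bézout : ∀ i j → gcd i j ≡ 1ℤ → ∃₂ λ u v → u * i + v * j ≡ 1ℤ
bézout i j gcd≡1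
  with s , si≡∣i∣ ← ∣i∣-multiple i
     | t , tj≡∣j∣ ← ∣i∣-multiple j
     | u , v , eq ← bézout-ℕ ∣ i ∣ ∣ j ∣ (coprime-Bézout (gcd≡1⇒coprime (+-injective gcd≡1)))
  = u * s , v * t , (begin
  u * s * i + v * t * j        ≡⟨ cong₂ _+_ (*-assoc u s i) (*-assoc v t j) ⟩
  u * (s * i) + v * (t * j)    ≡⟨ cong₂ (λ p q → u * p + v * q) si≡∣i∣ tj≡∣j∣ ⟩
  u * + ∣ i ∣ + v * + ∣ j ∣    ≡⟨ eq ⟩
  1ℤ                           ∎)
  where open ≡-Reasoning

*-nonNeg : ∀ n {i} → 0ℤ ≤ i → 0ℤ ≤ + n * i
*-nonNeg n {i} 0≤i = subst (_≤ + n * i) (*-zeroʳ (+ n)) (*-monoˡ-≤-nonNeg (+ n) 0≤i)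

0<1+i⇒0≤i : ∀ i → 0ℤ < 1ℤ + i → 0ℤ ≤ i
0<1+i⇒0≤i i 0<1+i = subst (0ℤ ≤_) (pred-suc i) (i<j⇒i≤pred[j] 0<1+i)

-- The `- 1ℤ` in the bound on `C` leaves a deficit of at most a - 1, just short of a whole multiple
-- of a: from aX ≥ -(a - 1) follows a(1 + X) ≥ 1, hence 1 + X > 0.
quotient-nonNeg : ∀ a p q z w {C X} → .{{NonZero a}} → z ℕ.< a → w ℕ.< a →
  C ≥ (+ a - 1ℤ) * (+ p - 1ℤ + + q) →
  C ≡ + a * X + (+ p * + z + + q * + w) →
  0ℤ ≤ X
quotient-nonNeg (ℕ.suc n) p q z w {C} {X} (ℕ.s≤s z-bound) (ℕ.s≤s w-bound) C≥ C≡ =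
  0<1+i⇒0≤i X (*-cancelˡ-<-nonNeg (+ ℕ.suc n) (begin-strict
    + ℕ.suc n * 0ℤ        ≡⟨ *-zeroʳ (+ ℕ.suc n) ⟩
    0ℤ                    <⟨ +<+ ℕ.z<s ⟩
    1ℤ + 0ℤ               ≤⟨ +-monoʳ-≤ 1ℤ slack≥0 ⟩
    1ℤ + slack C          ≡⟨ cong (λ C → 1ℤ + slack C) C≡ ⟩
    1ℤ + slack (+ ℕ.suc n * X + (+ p * + z + + q * + w))
                          ≡⟨ expand (+ n) (+ p) (+ q) (+ z) (+ w) X ⟩
    + ℕ.suc n * (1ℤ + X)  ∎))
  where
  open ≤-Reasoning
  -- Here n = a - 1. The three summands are the slacks in the bounds on `C`, `z` and `w`; the terms
  -- np and nq cancel, leaving C - pz - qw + n = aX + a - 1.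
  slack : ℤ → ℤ
  slack C = (C - + n * (+ p - 1ℤ + + q)) + (+ p * (+ n - + z) + + q * (+ n - + w))
  slack≥0 : 0ℤ ≤ slack C
  slack≥0 = +-mono-≤ (i≤j⇒0≤j-i C≥)
    (+-mono-≤ (*-nonNeg p (i≤j⇒0≤j-i (+≤+ z-bound))) (*-nonNeg q (i≤j⇒0≤j-i (+≤+ w-bound))))
  expand : ∀ n p q z w X →
    1ℤ + (((1ℤ + n) * X + (p * z + q * w) - n * (p - 1ℤ + q)) + (p * (n - z) + q * (n - w)))
      ≡ (1ℤ + n) * (1ℤ + X)
  expand = solve-∀

-- Cramer's rule modulo a: up to multiples of a, (z , w) is v times the adjugate
-- matrix applied to (A , B), where v inverts the determinant.
module _ (a b c m A B u v : ℤ) (unit : u * a + v * (b ^ 2 - c ^ 2 * m) ≡ 1ℤ)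
         (z w q r : ℤ)
         (z≡ : v * (b * A - c * m * B) ≡ z + q * a)
         (w≡ : v * (b * B - c * A) ≡ w + r * a)
         where

  open ≡-Reasoning

  cramer-rational : A ≡ a * (u * A + b * q + c * m * r) + (b * z + c * m * w)
  cramer-rational = begin
    A                                              ≡⟨ *-identityˡ A ⟨
    1ℤ * A                                         ≡⟨ cong (_* A) unit ⟨
    (u * a + v * (b ^ 2 - c ^ 2 * m)) * A          ≡⟨⟩
    (u * a + v * (b * (b * 1ℤ) - c * (c * 1ℤ) * m)) * A
      -- The terms in `B` cancel: b(bA - cmB) + cm(bB - cA) = (b² - c²m)A.
      ≡⟨ solve (a ∷ b ∷ c ∷ m ∷ A ∷ B ∷ u ∷ v ∷ []) ⟩
    u * a * A + (b * (v * (b * A - c * m * B)) + c * m * (v * (b * B - c * A)))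
      ≡⟨ cong₂ (λ Z W → u * a * A + (b * Z + c * m * W)) z≡ w≡ ⟩
    u * a * A + (b * (z + q * a) + c * m * (w + r * a))
      ≡⟨ solve (a ∷ b ∷ c ∷ m ∷ A ∷ u ∷ z ∷ w ∷ q ∷ r ∷ []) ⟩
    a * (u * A + b * q + c * m * r) + (b * z + c * m * w) ∎

  cramer-surd : B ≡ a * (u * B + b * r + c * q) + (b * w + c * z)
  cramer-surd = begin
    B                                              ≡⟨ *-identityˡ B ⟨
    1ℤ * B                                         ≡⟨ cong (_* B) unit ⟨
    (u * a + v * (b ^ 2 - c ^ 2 * m)) * B          ≡⟨⟩
    (u * a + v * (b * (b * 1ℤ) - c * (c * 1ℤ) * m)) * B
      -- Here the terms in `A` cancel instead: b(bB - cA) + c(bA - cmB) = (b² - c²m)B.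
      ≡⟨ solve (a ∷ b ∷ c ∷ m ∷ A ∷ B ∷ u ∷ v ∷ []) ⟩
    u * a * B + (b * (v * (b * B - c * A)) + c * (v * (b * A - c * m * B)))
      ≡⟨ cong₂ (λ Z W → u * a * B + (b * W + c * Z)) z≡ w≡ ⟩
    u * a * B + (b * (w + r * a) + c * (z + q * a))
      ≡⟨ solve (a ∷ b ∷ c ∷ B ∷ u ∷ z ∷ w ∷ q ∷ r ∷ []) ⟩
    a * (u * B + b * r + c * q) + (b * w + c * z)  ∎

theorem1 : (m : ℕ) → .{{NonZero m}} → ¬ PerfectSquare m →
    (a b c : ℕ) → .{{NonZero a}} → .{{NonZero b}} → .{{NonZero c}} →
    gcd (+ a) ((+ b) ^ 2 - (+ c) ^ 2 * (+ m)) ≡ 1ℤ →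
    (A B : ℤ) →
    A ≥ (+ a - 1ℤ) * (+ b - 1ℤ + + c * + m) →
    B ≥ (+ a - 1ℤ) * (+ b - 1ℤ + + c) →
    ∃[ x ] ∃[ y ] ∃[ z ] ∃[ w ]
    _≡_ {A = ℤ[√ m ]}
    (⟦ + a ⟧ ⊗ (+ x +√ + y) ⊕ (+ b +√ + c) ⊗ (+ z +√ + w))
    (A +√ B)
theorem1 m _ a b c gcd≡1 A B A≥ B≥
  with u , v , unit ← bézout (+ a) ((+ b) ^ 2 - (+ c) ^ 2 * (+ m)) gcd≡1
  -- Absolute values supply natural numbers; `X≥0` and `Y≥0` show that they do not change `X` and
  -- `Y`.
  = ∣ X ∣ , ∣ Y ∣ , z , w , cong₂ _+√_ rational≡ surd≡
  where
  N P X Y : ℤ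
  -- `N` and `P` solve the two congruences modulo `a`. Replacing them by their remainders `z` and
  -- `w` moves the quotients into `X` and `Y`.
  N = v * (+ b * A - + c * + m * B)
  P = v * (+ b * B - + c * A)
  z w : ℕ
  z = N %ℕ a
  w = P %ℕ a
  X = u * A + + b * (N /ℕ a) + + c * + m * (P /ℕ a)
  Y = u * B + + b * (P /ℕ a) + + c * (N /ℕ a)

  A≡ : A ≡ + a * X + (+ b * + z + + c * + m * + w)
  A≡ = cramer-rational (+ a) (+ b) (+ c) (+ m) A B u v unit (+ z) (+ w) (N /ℕ a) (P /ℕ a)
         (a≡a%ℕn+[a/ℕn]*n N a) (a≡a%ℕn+[a/ℕn]*n P a)

  B≡ : B ≡ + a * Y + (+ b * + w + + c * + z)
  B≡ = cramer-surd (+ a) (+ b) (+ c) (+ m) A B u v unit (+ z) (+ w) (N /ℕ a) (P /ℕ a)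
         (a≡a%ℕn+[a/ℕn]*n N a) (a≡a%ℕn+[a/ℕn]*n P a)

  +cm : + (c ℕ.* m) ≡ + c * + m
  +cm = pos-* c m

  X≥0 : 0ℤ ≤ X
  X≥0 = quotient-nonNeg a b (c ℕ.* m) z w (n%ℕd<d N a) (n%ℕd<d P a)
    (subst (λ k → A ≥ (+ a - 1ℤ) * (+ b - 1ℤ + k)) (sym +cm) A≥)
    (subst (λ k → A ≡ + a * X + (+ b * + z + k * + w)) (sym +cm) A≡)

  Y≥0 : 0ℤ ≤ Y
  -- In the surd equation `b` multiplies `w` and `c` multiplies `z`, so the two residues trade
  -- places.
  Y≥0 = quotient-nonNeg a b c w z (n%ℕd<d P a) (n%ℕd<d N a) B≥ B≡

  open ≡-Reasoning

  rational≡ : + a * + ∣ X ∣ + + m * (0ℤ * + ∣ Y ∣) + (+ b * + z + + m * (+ c * + w)) ≡ A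
  rational≡ = begin
    + a * + ∣ X ∣ + + m * (0ℤ * + ∣ Y ∣) + (+ b * + z + + m * (+ c * + w))
      ≡⟨ regroup (+ a) (+ b) (+ c) (+ m) (+ ∣ X ∣) (+ ∣ Y ∣) (+ z) (+ w) ⟩
    + a * + ∣ X ∣ + (+ b * + z + + c * + m * + w)
      ≡⟨ cong (λ x → + a * x + (+ b * + z + + c * + m * + w)) (0≤i⇒+∣i∣≡i X≥0) ⟩
    + a * X + (+ b * + z + + c * + m * + w)
      ≡⟨ A≡ ⟨
    A ∎
    where
    regroup : ∀ a b c m x y z w →
      a * x + m * (0ℤ * y) + (b * z + m * (c * w)) ≡ a * x + (b * z + c * m * w)
    regroup = solve-∀

  surd≡ : + a * + ∣ Y ∣ + 0ℤ * + ∣ X ∣ + (+ b * + w + + c * + z) ≡ B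
  surd≡ = begin
    + a * + ∣ Y ∣ + 0ℤ * + ∣ X ∣ + (+ b * + w + + c * + z)
      ≡⟨ cong (_+ (+ b * + w + + c * + z)) (+-identityʳ (+ a * + ∣ Y ∣)) ⟩
    + a * + ∣ Y ∣ + (+ b * + w + + c * + z)
      ≡⟨ cong (λ y → + a * y + (+ b * + w + + c * + z)) (0≤i⇒+∣i∣≡i Y≥0) ⟩
    + a * Y + (+ b * + w + + c * + z)
      ≡⟨ B≡ ⟨
    B ∎
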